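{- Most linear operators $M : \{0,1\}^n \to \{0,1\}^{O(n)}$ require $w \geq \Omega(n \cdot \log^{1/d}(n))$ wires when computed by a circuit of depth $d$ with arbitrary gates. That is, there exist absolute constants $C \geq 1$ (an integer) and $c > 0$ such that for every choice of depth $d = d(n) \geq 1$, if $M \in \mathbb{F}_2^{Cn \times n}$ is chosen uniformly at random, then with probability $1 - o(1)$ as $n \to \infty$, every depth-$d$ circuit with arbitrary gates that computes $x \mapsto Mx$ has at least $c \cdot n \cdot (\log n)^{1/d}$ wires.
   Context: Identify $\{0,1\}$ with $\mathbb{F}_2$. A circuit with arbitrary gates computing an operator $f:\{0,1\}^n\to\{0,1\}^m$ is a directed acyclic graph whose sources are the $n$ input variables and in which every other node (gate) has unbounded fan-in and computes an arbitrary Boolean function of the values of its in-neighbours; $m$ designated nodes output the $m$ coordinates of $f$. The depth is the length of the longest directed path from an input to an output. The number of wires $w$ is the number of edges. The circuit computes $f$ if its outputs equal $f(x)$ for every $x\in\{0,1\}^n$. Logarithms are base 2. -}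

module Defs where

open import Data.Bool.Base using (Bool; false; _∧_; _xor_)
open import Data.Empty using (⊥)
open import Data.Fin.Base using (Fin)
open import Data.Integer.Base as ℤ using (∣_∣)
open import Data.Nat.Base using (ℕ; suc; _+_; _*_; _^_; _≤_; NonZero)
open import Data.Nat.Properties using (m^n≢0)
open import Data.Product.Base using (Σ-syntax; ∃-syntax; _×_)
open import Data.Rational.Base as ℚ using (ℚ; ↥_; ↧ₙ_; 0ℚ; 1ℚ)
open import Data.Vec.Base using (Vec; map; foldr′; zipWith; lookup; sum; tabulate)
open import Data.Vec.Membership.Propositional using (_∈_)
open import Data.Vec.Relation.Unary.Unique.Propositional using (Unique)
open import Function.Definitions using (Injective)
open import Relation.Binary.PropositionalEquality.Core using (_≡_)
open import Relation.Nullary.Negation.Core using (¬_)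

-- 𝔽₂ is Bool, with _xor_ as addition and _∧_ as multiplication.
Matrix : ℕ → ℕ → Set
Matrix m n = Vec (Vec Bool n) m

infixr 7 _·_

_·_ : ∀ {m n} → Matrix m n → Vec Bool n → Vec Bool m
M · x = map (λ row → foldr′ _xor_ false (zipWith _∧_ row x)) M

data Node (n s : ℕ) : Set where
  input : Fin n → Node n s
  gate  : Fin s → Node n s

module _ {n s : ℕ} {fanIn : Fin s → ℕ} (preds : (g : Fin s) → Vec (Node n s) (fanIn g)) where

  Wire : Node n s → Node n s → Set
  Wire u (input _) = ⊥
  Wire u (gate g)  = u ∈ preds g

  data Path : Node n s → Node n s → ℕ → Set where
    []  : ∀ {u} → Path u u 0
    _∷_ : ∀ {u v w ℓ} → Wire u v → Path v w ℓ → Path u w (suc ℓ)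

-- The in-neighbours of a gate are listed without repetition, so that wires are
-- the edges of a simple digraph; the list order only fixes the order of the
-- arguments of the gate's Boolean function.  Every gate has at least one
-- in-neighbour, so the sources of the digraph are exactly the inputs.
record Circuit (n m : ℕ) : Set where
  field
    gates         : ℕ
    fanIn         : Fin gates → ℕ
    preds         : (g : Fin gates) → Vec (Node n gates) (fanIn g)
    fanIn-nonZero : ∀ g → NonZero (fanIn g)
    preds-unique  : ∀ g → Unique (preds g)
    acyclic       : ∀ u ℓ → ¬ Path preds u u (suc ℓ)
    op            : (g : Fin gates) → Vec Bool (fanIn g) → Bool
    output        : Vec (Node n gates) m

  wires : ℕ
  wires = sum (tabulate fanIn)

  HasDepth : ℕ → Set
  HasDepth k =
    (∃[ i ] ∃[ j ] Path preds (input i) (lookup output j) k) ×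
    (∀ i j ℓ → Path preds (input i) (lookup output j) ℓ → ℓ ≤ k)

  record IsValuation (x : Vec Bool n) (val : Node n gates → Bool) : Set where
    field
      atInput : ∀ i → val (input i) ≡ lookup x i
      atGate  : ∀ g → val (gate g) ≡ op g (map val (preds g))

  -- By acyclicity each x has exactly one valuation (up to pointwise equality),
  -- so the existential quantifier just names the values computed on x.
  Computes : (Vec Bool n → Vec Bool m) → Set
  Computes f = ∀ x → ∃[ val ] IsValuation x val × map val output ≡ f x

-- w ≥ c · n · (log₂ n)^(1/d), for n, d ≥ 1 and c = p / q > 0.  Multiplying by q,
-- raising to the power d and exponentiating in base 2 (all strictly monotone on
-- the nonnegative reals) turns it into the equivalent inequality
--   n ^ ((p n) ^ d) ≤ 2 ^ ((q w) ^ d).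
AtLeast-c·n·log^1/d : (c : ℚ) (n d w : ℕ) → Set
AtLeast-c·n·log^1/d c n d w = n ^ ((∣ ↥ c ∣ * n) ^ d) ≤ 2 ^ ((↧ₙ c * w) ^ d)

-- Pr[ P M ] ≥ p for M uniform among the 2 ^ (m * n) matrices: at least k distinct
-- matrices satisfy P, for some k with k / 2 ^ (m * n) ≥ p.
ProbAtLeast : ∀ {m n} → ℚ → (Matrix m n → Set) → Set
ProbAtLeast {m} {n} p P =
  Σ[ k ∈ ℕ ] p ℚ.≤ ℚ._/_ (ℤ.+ k) (2 ^ (m * n)) {{m^n≢0 2 (m * n)}} ×
  (∃[ f ] Injective {A = Fin k} _≡_ _≡_ f × (∀ i → P (f i)))

-- Probability 1 - o(1) as n → ∞.
WithHighProbability : (rows : ℕ → ℕ) → (∀ n → Matrix (rows n) n → Set) → Set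
WithHighProbability rows P =
  ∀ (ε : ℚ) → 0ℚ ℚ.< ε → ∃[ N ] (∀ n → N ≤ n → ProbAtLeast (1ℚ ℚ.- ε) (P n))

-- A depth-d circuit is one whose depth is at most d.
RequiresWires : (c : ℚ) (d : ℕ) → ∀ {m} n → Matrix m n → Set
RequiresWires c d {m} n M =
  (K : Circuit n m) (k : ℕ) → Circuit.HasDepth K k → k ≤ d →
  Circuit.Computes K (M ·_) →
  AtLeast-c·n·log^1/d c n d (Circuit.wires K)

{-# OPTIONS --safe #-}

-- A circuit with few wires is turned into a probe scheme. Let τ = max 1 ⌊w/n⌋. At
-- most n gates have fan-in larger than τ; store the input together with the values
-- of these heavy gates, 2n bits in all. In depth d every output is then a Boolean
-- function of at most τ^d stored bits. If w < (n/4) (log n)^(1/d), then τ^d ≤ T with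
-- T = ⌊⌊log n⌋/4⌋, so the way all 4n outputs are read off the memory is described by
-- o(n²) bits, although the map from x to the memory is arbitrary: a linear operator
-- is determined by its columns, hence by the way of reading and the memories of the
-- n unit vectors, which take 2n² further bits. So at most 2^(2n² + o(n²)) of the
-- 2^(4n²) matrices have such circuits.
module Submission where

open import Defs
open import Data.Bool.Base using (Bool; true; false; _∧_; _xor_)
open import Data.Bool.Properties as Bool using (∧-identityʳ; ∧-zeroʳ; xor-identityʳ)
open import Data.Fin.Base as Fin using (Fin; zero; suc; toℕ; combine; remQuot; finToFun; funToFin; punchIn)
open import Data.Fin.Properties as Fin using (2↔Bool; any?; pigeonhole; remQuot-combine; combine-remQuot;
  finToFun-funToFin; funToFin-finToFin; punchIn-injective; punchInᵢ≢i)
import Data.Integer.Base as ℤ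
import Data.Integer.Properties as ℤ
open import Data.List.Base as List using (List; []; _∷_; _++_; length)
open import Data.List.Membership.Propositional using () renaming (_∈_ to _∈ₗ_)
open import Data.List.Membership.Propositional.Properties using (∈-++⁺ˡ; ∈-++⁺ʳ; ∈-filter⁺; ∈-allFin; ∈-map⁺)
import Data.List.Properties as List
open import Data.List.Relation.Unary.All as All using (All; []; _∷_)
import Data.List.Relation.Unary.All.Properties as All
open import Data.List.Relation.Unary.Any using (here; there)
open import Data.Nat.Base
open import Data.Nat.DivMod using (_/_; _%_; m≡m%n+[m/n]*n; m%n<n; m*n/n≡m; m/n*n≤m; /-monoˡ-≤; m≥n⇒m/n>0)
open import Data.Nat.Properties
open import Data.Nat.Tactic.RingSolver using (solve-∀)
open import Data.Product.Base
open import Data.Rational.Base as ℚ using (0ℚ; 1ℚ; mkℚ; ↧ₙ_)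
import Data.Rational.Properties as ℚ
open import Data.Rational.Unnormalised.Base as ℚᵘ using (mkℚᵘ)
import Data.Rational.Unnormalised.Properties as ℚᵘ
open import Data.Sum.Base using (_⊎_; inj₁; inj₂)
open import Data.Vec.Base as Vec using (Vec; []; _∷_; lookup; tabulate; replicate; zipWith; foldr′; _[_]≔_)
open import Data.Vec.Membership.Propositional using (_∈_)
import Data.Vec.Properties as Vec
import Data.Vec.Relation.Unary.Any as VecAny
open import Function.Base using (_∘_; id)
open import Function.Bundles using (module Inverse)
open import Function.Definitions using (Injective)
open import Relation.Binary.Definitions using (DecidableEquality)
open import Relation.Binary.PropositionalEquality
open import Relation.Nullary.Decidable.Core using (yes; no; map′; decidable-stable)
open import Relation.Nullary.Negation.Core using (¬_; contradiction)

open Inverse 2↔Bool using ()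
  renaming (to to bool; from to bit; strictlyInverseˡ to bool-bit; strictlyInverseʳ to bit-bool)

private variable
  X : Set
  n m k b c s T N : ℕ

-- Counting and padding for lists and vectors.

some-member : .{{NonZero k}} → (xs : Vec X k) → ∃[ x ] x ∈ xs
some-member (x ∷ _) = x , VecAny.here refl

-- Markov's inequality in counting form: every entry that passes the filter contributes at least `t`
-- to the sum, and the others contribute at least 0.
length-filter*≤sum : ∀ t (g : Fin k → X) (f : X → ℕ) →
  length (List.filter (λ a → t ≤? f a) (List.tabulate g)) * t ≤ Vec.sum (Vec.tabulate (f ∘ g))
length-filter*≤sum {k = zero}  t g f = z≤n
length-filter*≤sum {k = suc k} t g f with t ≤? f (g zero)
... | yes p rewrite List.filter-accept (λ a → t ≤? f a) {xs = List.tabulate (g ∘ suc)} p =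
  +-mono-≤ p (length-filter*≤sum t (g ∘ suc) f)
... | no ¬p rewrite List.filter-reject (λ a → t ≤? f a) {xs = List.tabulate (g ∘ suc)} ¬p =
  m≤n⇒m≤o+n (f (g zero)) (length-filter*≤sum t (g ∘ suc) f)

-- Pads with a default value, so that stores and probe lists get a fixed size and can be counted as
-- functions on `Fin k`.
list-as-family : (xs : List X) → X → length xs ≤ k →
  Σ[ f ∈ (Fin k → X) ] (∀ {x} → x ∈ₗ xs → ∃[ i ] f i ≡ x)
list-as-family []       a _       = (λ _ → a) , λ ()
list-as-family (x ∷ xs) a (s≤s p) with list-as-family xs a p
... | f , covers = (λ { zero → x ; (suc i) → f i })
                 , λ { (here refl) → zero , refl
                     ; (there x∈xs) → map suc id (covers x∈xs) }

infix 4 _≟ⁿ_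

_≟ⁿ_ : DecidableEquality (Node n k)
input i ≟ⁿ input j = map′ (cong input) (λ { refl → refl }) (i Fin.≟ j)
input i ≟ⁿ gate  h = no λ ()
gate  g ≟ⁿ input j = no λ ()
gate  g ≟ⁿ gate  h = map′ (cong gate) (λ { refl → refl }) (g Fin.≟ h)

-- Unfolding a shallow circuit down to stored nodes.

module _ (K : Circuit n m) where
  open Circuit K

  private
    V : Set
    V = Node n gates

  snoc : ∀ {u v w ℓ} → Path preds u v ℓ → Wire preds v w → Path preds u w (suc ℓ)
  snoc []      e = e ∷ []
  snoc (e ∷ p) f = e ∷ snoc p f

  -- The depth bound speaks only of paths that start at an input. A gate without such a path would
  -- satisfy every bound vacuously, so these gates must be excluded before recursion on depth makes
  -- sense.
  Unreachable : Set
  Unreachable = Σ[ g ∈ Fin gates ] (∀ i ℓ → ¬ Path preds (input i) (gate g) ℓ)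

  unreachable-pred : (u : Unreachable) →
    Σ[ v ∈ Unreachable ] Wire preds (gate (proj₁ v)) (gate (proj₁ u))
  unreachable-pred (g , ¬p) with some-member {{fanIn-nonZero g}} (preds g)
  ... | input i , e = contradiction (e ∷ []) (¬p i 1)
  ... | gate h  , e = (h , λ i ℓ p → ¬p i (suc ℓ) (snoc p e)) , e

  -- An unreachable gate would start an infinite backward walk, which revisits a gate.
  no-unreachable : ¬ Unreachable
  no-unreachable u = cycle (pigeonhole (n<1+n gates) (proj₁ ∘ walk ∘ toℕ))
    where
    walk : ℕ → Unreachable
    walk zero    = u
    walk (suc t) = proj₁ (unreachable-pred (walk t))

    path : ∀ j t → Path preds (gate (proj₁ (walk (j + t)))) (gate (proj₁ (walk t))) j
    path zero    t = []
    path (suc j) t = proj₂ (unreachable-pred (walk (j + t))) ∷ path j t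

    cycle : ¬ (∃₂ λ (i j : Fin (suc gates)) → toℕ i < toℕ j × proj₁ (walk (toℕ i)) ≡ proj₁ (walk (toℕ j)))
    cycle (i , j , i<j , eq) with m≤n⇒∃[o]m+o≡n i<j
    ... | r , i+r≡j = acyclic _ r
      (subst (λ g → Path preds (gate g) (gate (proj₁ (walk (toℕ i)))) (suc r)) same (path (suc r) (toℕ i)))
      where
      same : proj₁ (walk (suc r + toℕ i)) ≡ proj₁ (walk (toℕ i))
      same = trans (cong (proj₁ ∘ walk) (trans (cong suc (+-comm r (toℕ i))) i+r≡j)) (sym eq)

  module _ (Stored : V → Set) where

    -- read is the same function for every x; locality replaces an explicit list of arguments.
    record Reader (us : Vec V k) (b : ℕ) : Set where
      field
        leaves  : List V
        few     : length leaves ≤ b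
        stored  : All Stored leaves
        read    : (V → Bool) → Vec Bool k
        local   : ∀ {ρ ρ′} → (∀ {v} → v ∈ₗ leaves → ρ v ≡ ρ′ v) → read ρ ≡ read ρ′
        correct : ∀ {x val} → IsValuation x val → read val ≡ Vec.map val us

    open Reader

    stored-reader : ∀ {u} → Stored u → 1 ≤ b → Reader (u ∷ []) b
    stored-reader {u = u} st 1≤b = record
      { leaves  = u ∷ []
      ; few     = 1≤b
      ; stored  = st ∷ []
      ; read    = λ ρ → ρ u ∷ []
      ; local   = λ eq → cong (_∷ []) (eq (here refl))
      ; correct = λ _ → refl
      }

    []-reader : Reader [] 0
    []-reader = record
      { leaves  = []
      ; few     = z≤n
      ; stored  = []
      ; read    = λ _ → []
      ; local   = λ _ → refl
      ; correct = λ _ → refl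
      }

    ∷-reader : ∀ {u} {us : Vec V k} → Reader (u ∷ []) b → Reader us c → Reader (u ∷ us) (b + c)
    ∷-reader R Q = record
      { leaves  = leaves R ++ leaves Q
      ; few     = ≤-trans (≤-reflexive (List.length-++ (leaves R))) (+-mono-≤ (few R) (few Q))
      ; stored  = All.++⁺ (stored R) (stored Q)
      ; read    = λ ρ → read R ρ Vec.++ read Q ρ
      ; local   = λ eq → cong₂ Vec._++_ (local R (eq ∘ ∈-++⁺ˡ)) (local Q (eq ∘ ∈-++⁺ʳ (leaves R)))
      ; correct = λ v → cong₂ Vec._++_ (correct R v) (correct Q v)
      }

    all-reader : (us : Vec V k) → (∀ {u} → u ∈ us → Reader (u ∷ []) b) → Reader us (k * b)
    all-reader []       R = []-reader
    all-reader (u ∷ us) R = ∷-reader (R (VecAny.here refl)) (all-reader us (R ∘ VecAny.there))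

    gate-reader : ∀ {g} → Reader (preds g) b → b ≤ c → Reader (gate g ∷ []) c
    gate-reader {g = g} R b≤c = record
      { leaves  = leaves R
      ; few     = ≤-trans (few R) b≤c
      ; stored  = stored R
      ; read    = λ ρ → op g (read R ρ) ∷ []
      ; local   = λ eq → cong (λ v → op g v ∷ []) (local R eq)
      ; correct = λ v → cong (_∷ []) (trans (cong (op g) (correct R v)) (sym (IsValuation.atGate v g)))
      }

    module _ {τ : ℕ} (1≤τ : 1 ≤ τ) (input-stored : ∀ i → Stored (input i))
             (stored-or-light : ∀ g → Stored (gate g) ⊎ fanIn g ≤ τ) where

      private
        1≤τ^ : ∀ r → 1 ≤ τ ^ r
        1≤τ^ r = m^n>0 τ {{>-nonZero 1≤τ}} r

      -- Unfolding stops at stored nodes, so it branches only at light gates, at most `τ` ways each,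
      -- and each level uses up one unit of the depth bound `r`.
      reader : ∀ r u → (∀ i ℓ → Path preds (input i) u ℓ → ℓ ≤ r) → Reader (u ∷ []) (τ ^ r)
      reader r (input i) _ = stored-reader (input-stored i) (1≤τ^ r)
      reader r (gate g)  bound with stored-or-light g
      ... | inj₁ st = stored-reader st (1≤τ^ r)
      -- A path of length 0 from an input ends at that input, so under the bound 0 no input reaches
      -- this gate.
      reader zero    (gate g) bound | inj₂ light =
        contradiction (g , λ { i zero () ; i (suc ℓ) p → contradiction (bound i _ p) λ () }) no-unreachable
      reader (suc r) (gate g) bound | inj₂ light =
        gate-reader
          (all-reader (preds g) λ {u} e → reader r u λ i ℓ p → s≤s⁻¹ (bound i (suc ℓ) (snoc p e)))
          (*-monoˡ-≤ (τ ^ r) light)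

-- Finite families with some values removed.

funToFin-cong : {f g : Fin k → Fin n} → f ≗ g → funToFin f ≡ funToFin g
funToFin-cong {k = zero}  eq = refl
funToFin-cong {k = suc k} eq = cong₂ combine (eq zero) (funToFin-cong (eq ∘ suc))

Embedding : ℕ → Set → Set
Embedding k X = Σ[ f ∈ (Fin k → X) ] Injective _≡_ _≡_ f

-- Injectivity leaves at most one index to skip. The last component says that no new values appear,
-- so values excluded earlier stay excluded.
remove : DecidableEquality X → (e : Embedding N X) (x : X) →
  Σ[ f ∈ Embedding (pred N) X ] (∀ i → proj₁ f i ≢ x) × (∀ i → ∃[ j ] proj₁ e j ≡ proj₁ f i)
remove {N = zero}  _≟_ e       x = e , (λ ()) , λ ()
remove {N = suc N} _≟_ (e , e-inj) x with any? (λ i → e i ≟ x)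
... | yes (i , eᵢ≡x) =
  (e ∘ punchIn i , punchIn-injective i _ _ ∘ e-inj) ,
  (λ j eq → punchInᵢ≢i i j (e-inj (trans eq (sym eᵢ≡x)))) ,
  (λ j → punchIn i j , refl)
-- Nothing has to go, but index zero is dropped so that the size is `pred N` in both cases.
... | no ∄i =
  (e ∘ suc , Fin.suc-injective ∘ e-inj) ,
  (λ j eq → ∄i (suc j , eq)) ,
  (λ j → suc j , refl)

remove-all : DecidableEquality X → Embedding N X → (g : Fin b → X) →
  Σ[ f ∈ Embedding (N ∸ b) X ] (∀ i j → proj₁ f i ≢ g j)
remove-all {b = zero}  _≟_ e g = e , λ _ ()
remove-all {N = N} {b = suc b} _≟_ e g with remove-all _≟_ e (g ∘ suc)
... | f , f∌ with remove _≟_ f (g zero)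
... | h , h∌ , h⊆f = subst (λ k → Σ[ f ∈ Embedding k _ ] (∀ i j → proj₁ f i ≢ g j)) (pred[m∸n]≡m∸[1+n] N b)
  (h , λ { i zero → h∌ i ; i (suc j) eq → f∌ (proj₁ (h⊆f i)) j (trans (proj₂ (h⊆f i)) eq) })

-- Coding matrices by numbers.

matrix : (Fin m → Fin n → Bool) → Matrix m n
matrix a = tabulate λ j → tabulate (a j)

lookup-matrix : ∀ (a : Fin m → Fin n → Bool) j i → lookup (lookup (matrix a) j) i ≡ a j i
lookup-matrix a j i =
  trans (cong (λ v → lookup v i) (Vec.lookup∘tabulate _ j)) (Vec.lookup∘tabulate (a j) i)

matrix-lookup : ∀ (M : Matrix m n) → matrix (λ j i → lookup (lookup M j) i) ≡ M
matrix-lookup M = trans (Vec.tabulate-cong λ j → Vec.tabulate∘lookup (lookup M j)) (Vec.tabulate∘lookup M)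

matrices : Embedding (2 ^ (m * n)) (Matrix m n)
matrices {m} {n} = fromCode , injective
  where
  fromCode : Fin (2 ^ (m * n)) → Matrix m n
  fromCode c = matrix λ j i → bool (finToFun {2} {m * n} c (combine j i))

  bits : ∀ c j i → finToFun c (combine j i) ≡ bit (lookup (lookup (fromCode c) j) i)
  bits c j i = trans (sym (bit-bool _)) (cong bit (sym (lookup-matrix _ j i)))

  injective : Injective _≡_ _≡_ fromCode
  injective {c} {c′} eq =
    trans (sym (funToFin-finToFin {m * n} {2} c)) (trans (funToFin-cong same) (funToFin-finToFin {m * n} {2} c′))
    where
    same : finToFun c ≗ finToFun c′
    same p = subst (λ q → finToFun c q ≡ finToFun c′ q) (combine-remQuot {m} n p)
      (trans (bits c _ _) (trans (cong (λ M → bit (lookup (lookup M _) _)) eq) (sym (bits c′ _ _))))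

-- Probe schemes and the matrices they describe.

-- A query consists of T addresses among s memory cells and a truth table on T bits.
#queries : (s T : ℕ) → ℕ
#queries s T = s ^ T * 2 ^ (2 ^ T)

run : Fin (#queries s T) → Fin (2 ^ s) → Bool
run {s} {T} query memory =
  let probes , table = remQuot {s ^ T} (2 ^ (2 ^ T)) query
  in bool (finToFun table (funToFin (finToFun {2} {s} memory ∘ finToFun {s} {T} probes)))

run-encoded : (probes : Fin T → Fin s) (table : Fin (2 ^ T) → Fin 2) (memory : Fin s → Fin 2) →
  run {s} {T} (combine (funToFin probes) (funToFin table)) (funToFin memory) ≡
  bool (table (funToFin (memory ∘ probes)))
run-encoded {T} {s} probes table memory = begin
  evaluate (remQuot {s ^ T} (2 ^ (2 ^ T)) (combine (funToFin probes) (funToFin table)))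
    ≡⟨ cong evaluate (remQuot-combine (funToFin probes) (funToFin table)) ⟩
  evaluate (funToFin probes , funToFin table)
    ≡⟨ cong bool (finToFun-funToFin table _) ⟩
  bool (table (funToFin (finToFun {2} {s} (funToFin memory) ∘ finToFun {s} {T} (funToFin probes))))
    ≡⟨ cong (bool ∘ table) (funToFin-cong λ p →
         trans (finToFun-funToFin memory _) (cong memory (finToFun-funToFin probes p))) ⟩
  bool (table (funToFin (memory ∘ probes))) ∎
  where
  open ≡-Reasoning
  evaluate : Fin (s ^ T) × Fin (2 ^ (2 ^ T)) → Bool
  evaluate (p , t) = bool (finToFun t (funToFin (finToFun {2} {s} (funToFin memory) ∘ finToFun {s} {T} p)))

module _ (m n s T : ℕ) where

  -- One query for each of the `m` outputs, and one memory of `s` bits for each of the `n` unit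
  -- vectors.
  #probe-schemes : ℕ
  #probe-schemes = #queries s T ^ m * (2 ^ s) ^ n

  private
    split : Fin #probe-schemes → Fin (#queries s T ^ m) × Fin ((2 ^ s) ^ n)
    split = remQuot {#queries s T ^ m} ((2 ^ s) ^ n)

  scheme-entry : Fin #probe-schemes → Fin m → Fin n → Bool
  scheme-entry c j i = run {s} {T} (finToFun (proj₁ (split c)) j) (finToFun (proj₂ (split c)) i)

  scheme-matrix : Fin #probe-schemes → Matrix m n
  scheme-matrix c = matrix (scheme-entry c)

  scheme-matrix-complete : (M : Matrix m n)
    (probes : Fin m → Fin T → Fin s) (table : Fin m → Fin (2 ^ T) → Fin 2) (memory : Fin n → Fin s → Fin 2) →
    (∀ j i → bool (table j (funToFin (memory i ∘ probes j))) ≡ lookup (lookup M j) i) →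
    ∃[ c ] scheme-matrix c ≡ M
  scheme-matrix-complete M probes table memory eq = code ,
    trans (Vec.tabulate-cong λ j → Vec.tabulate-cong λ i → trans (entry j i) (eq j i)) (matrix-lookup M)
    where
    query : Fin m → Fin (#queries s T)
    query j = combine (funToFin (probes j)) (funToFin (table j))

    code : Fin #probe-schemes
    code = combine (funToFin query) (funToFin (funToFin ∘ memory))

    split-code : split code ≡ (funToFin query , funToFin (funToFin ∘ memory))
    split-code = remQuot-combine (funToFin query) (funToFin (funToFin ∘ memory))

    entry : ∀ j i → scheme-entry code j i ≡ bool (table j (funToFin (memory i ∘ probes j)))
    entry j i = trans
      (cong₂ (run {s} {T})
        (trans (cong (λ c → finToFun (proj₁ c) j) split-code) (finToFun-funToFin query j))
        (trans (cong (λ c → finToFun (proj₂ c) i) split-code) (finToFun-funToFin (funToFin ∘ memory) i)))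
      (run-encoded (probes j) (table j) (memory i))

-- Columns of a matrix as its values on unit vectors.

⟨_,_⟩ : Vec Bool n → Vec Bool n → Bool
⟨ row , x ⟩ = foldr′ _xor_ false (zipWith _∧_ row x)

unit : Fin n → Vec Bool n
unit i = replicate _ false [ i ]≔ true

⟨,0⟩ : (row : Vec Bool n) → ⟨ row , replicate n false ⟩ ≡ false
⟨,0⟩ []        = refl
⟨,0⟩ (a ∷ row) = cong₂ _xor_ (∧-zeroʳ a) (⟨,0⟩ row)

⟨,unit⟩ : (row : Vec Bool n) (i : Fin n) → ⟨ row , unit i ⟩ ≡ lookup row i
⟨,unit⟩ (a ∷ row) zero    = trans (cong₂ _xor_ (∧-identityʳ a) (⟨,0⟩ row)) (xor-identityʳ a)
⟨,unit⟩ (a ∷ row) (suc i) = cong₂ _xor_ (∧-zeroʳ a) (⟨,unit⟩ row i)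

lookup-·-unit : (M : Matrix m n) (j : Fin m) (i : Fin n) → lookup (M · unit i) j ≡ lookup (lookup M j) i
lookup-·-unit M j i = trans (Vec.lookup-map j _ M) (⟨,unit⟩ (lookup M j) i)

-- From a circuit with few wires to a probe scheme.

module _ (K : Circuit n m) where
  open Circuit K

  -- If `n` gates had fan-in above `τ`, they alone would account for `n * suc τ` wires. Hence the
  -- inputs and the heavy gates fit into `n + n` cells; spare cells repeat the input `i₀`.
  heavy-storage : Fin n → ∀ τ → wires < n * suc τ → Σ[ store ∈ (Fin (n + n) → Node n gates) ]
    (∀ i → ∃[ p ] store p ≡ input i) × (∀ g → (∃[ p ] store p ≡ gate g) ⊎ fanIn g ≤ τ)
  heavy-storage i₀ τ w<n[1+τ] =
    store , (λ i → covers (∈-++⁺ˡ (∈-map⁺ input (∈-allFin i)))) , stored-or-light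
    where
    heavy? = λ g → suc τ ≤? fanIn g

    inputs : List (Node n gates)
    inputs = List.map input (List.allFin n)

    heavy : List (Fin gates)
    heavy = List.filter heavy? (List.allFin gates)

    few-heavy : length heavy ≤ n
    few-heavy = <⇒≤ (*-cancelʳ-< (suc τ) (length heavy) n
      (≤-<-trans (length-filter*≤sum (suc τ) id fanIn) w<n[1+τ]))

    few : length (inputs ++ List.map gate heavy) ≤ n + n
    few = begin
      length (inputs ++ List.map gate heavy)
        ≡⟨ List.length-++ inputs ⟩
      length inputs + length (List.map gate heavy)
        ≡⟨ cong₂ _+_ (trans (List.length-map input (List.allFin n)) (List.length-tabulate {n = n} id))
                     (List.length-map gate heavy) ⟩
      n + length heavy
        ≤⟨ +-monoʳ-≤ n few-heavy ⟩
      n + n ∎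
      where open ≤-Reasoning

    family = list-as-family (inputs ++ List.map gate heavy) (input i₀) few
    store  = proj₁ family
    covers = proj₂ family

    stored-or-light : ∀ g → (∃[ p ] store p ≡ gate g) ⊎ fanIn g ≤ τ
    stored-or-light g with suc τ ≤? fanIn g
    ... | yes h = inj₁ (covers (∈-++⁺ʳ inputs (∈-map⁺ gate (∈-filter⁺ heavy? (∈-allFin g) h))))
    ... | no ¬h = inj₂ (s≤s⁻¹ (≰⇒> ¬h))

  -- Memory i holds the values of the stored nodes on unit i.
  circuit⇒scheme : ∀ {τ d T} (M : Matrix m n) → Fin n → 1 ≤ τ → wires < n * suc τ →
    (∀ i j ℓ → Path preds (input i) (lookup output j) ℓ → ℓ ≤ d) → τ ^ d ≤ T →
    Computes (M ·_) → ∃[ c ] scheme-matrix m n (n + n) T c ≡ M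
  circuit⇒scheme {τ} {d} {T} M i₀ 1≤τ w<n[1+τ] shallow τ^d≤T computes
    with heavy-storage i₀ τ w<n[1+τ]
  ... | store , input-stored , stored-or-light =
    scheme-matrix-complete m n (n + n) T M probes table memory correct-entry
    where
    Stored : Node n gates → Set
    Stored v = ∃[ p ] store p ≡ v

    R : ∀ j → Reader K Stored (lookup output j ∷ []) (τ ^ d)
    R j = reader K Stored 1≤τ input-stored stored-or-light d (lookup output j) (λ i → shallow i j)

    module R j = Reader (R j)

    val : Fin n → Node n gates → Bool
    val i = proj₁ (computes (unit i))

    address : Node n gates → Fin (n + n)
    address v with any? (λ p → store p ≟ⁿ v)
    ... | yes (p , _) = p
    -- An arbitrary cell: only addresses of leaves matter, and leaves are stored.
    ... | no _        = proj₁ (input-stored i₀)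

    store-address : ∀ {v} → Stored v → store (address v) ≡ v
    store-address {v} st with any? (λ p → store p ≟ⁿ v)
    ... | yes (_ , eq) = eq
    ... | no ¬st       = contradiction st ¬st

    leaf : ∀ j → Σ[ f ∈ (Fin T → Node n gates) ] (∀ {v} → v ∈ₗ R.leaves j → ∃[ p ] f p ≡ v)
    leaf j = list-as-family (R.leaves j) (input i₀) (≤-trans (R.few j) τ^d≤T)

    probes : Fin m → Fin T → Fin (n + n)
    probes j = address ∘ proj₁ (leaf j)

    -- Turns the `T` probed bits back into a partial valuation. It is filled up with `false`, which
    -- is harmless because the reader is local to its leaves.
    reconstruct : Fin m → Fin (2 ^ T) → Node n gates → Bool
    reconstruct j c v with any? (λ p → store (probes j p) ≟ⁿ v)
    ... | yes (p , _) = bool (finToFun c p)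
    ... | no _        = false

    table : Fin m → Fin (2 ^ T) → Fin 2
    table j c = bit (Vec.head (R.read j (reconstruct j c)))

    memory : Fin n → Fin (n + n) → Fin 2
    memory i = bit ∘ val i ∘ store

    reconstruct-leaf : ∀ j i {v} → v ∈ₗ R.leaves j → reconstruct j (funToFin (memory i ∘ probes j)) v ≡ val i v
    reconstruct-leaf j i {v} v∈ with any? (λ p → store (probes j p) ≟ⁿ v)
    ... | yes (p , eq) =
      trans (cong bool (finToFun-funToFin (memory i ∘ probes j) p)) (trans (bool-bit _) (cong (val i) eq))
    -- Impossible: a leaf occurs in the padded list that defines the probes, and its address leads
    -- back to it.
    ... | no ∄p with proj₂ (leaf j) v∈
    ...   | p , refl = contradiction (p , store-address (All.lookup (R.stored j) v∈)) ∄p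

    correct-entry : ∀ j i → bool (table j (funToFin (memory i ∘ probes j))) ≡ lookup (lookup M j) i
    correct-entry j i = begin
      bool (table j (funToFin (memory i ∘ probes j)))
        ≡⟨ bool-bit _ ⟩
      Vec.head (R.read j (reconstruct j (funToFin (memory i ∘ probes j))))
        ≡⟨ cong Vec.head (R.local j (reconstruct-leaf j i)) ⟩
      Vec.head (R.read j (val i))
        ≡⟨ cong Vec.head (R.correct j (proj₁ (proj₂ (computes (unit i))))) ⟩
      val i (lookup output j)
        ≡⟨ Vec.lookup-map j (val i) output ⟨
      lookup (Vec.map (val i) output) j
        ≡⟨ cong (λ v → lookup v j) (proj₂ (proj₂ (computes (unit i)))) ⟩
      lookup (M · unit i) j
        ≡⟨ lookup-·-unit M j i ⟩
      lookup (lookup M j) i ∎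
      where open ≡-Reasoning

-- Arithmetic of the wire bound and of the number of schemes.

-- Here `ℓ` is the integer part of the binary logarithm; passing to the next number changes it only
-- on hitting a power of two.
log₂-bracket : ∀ n → 1 ≤ n → ∃[ ℓ ] 2 ^ ℓ ≤ n × n < 2 ^ suc ℓ
log₂-bracket 1             _ = 0 , s≤s z≤n , s≤s (s≤s z≤n)
log₂-bracket (suc n@(suc _)) _ with log₂-bracket n (s≤s z≤n)
... | ℓ , 2^ℓ≤n , n<2^[1+ℓ] with m≤n⇒m<n∨m≡n n<2^[1+ℓ]
...   | inj₁ 1+n<2^[1+ℓ] = ℓ , m≤n⇒m≤1+n 2^ℓ≤n , 1+n<2^[1+ℓ]
...   | inj₂ 1+n≡2^[1+ℓ] = suc ℓ , ≤-reflexive (sym 1+n≡2^[1+ℓ]) ,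
  subst (_< 2 ^ suc (suc ℓ)) (sym 1+n≡2^[1+ℓ]) (^-monoʳ-< 2 (s≤s (s≤s z≤n)) (n<1+n (suc ℓ)))

^-distribʳ-* : ∀ m n o → (m * n) ^ o ≡ m ^ o * n ^ o
^-distribʳ-* m n zero    = refl
^-distribʳ-* m n (suc o) = trans (cong (m * n *_) (^-distribʳ-* m n o)) (interchange m n (m ^ o) (n ^ o))
  where
  interchange : ∀ a b c d → a * b * (c * d) ≡ a * c * (b * d)
  interchange = solve-∀

m<n*[1+m/n] : ∀ m n .{{_ : NonZero n}} → m < n * suc (m / n)
m<n*[1+m/n] m n = begin-strict
  m                   ≡⟨ m≡m%n+[m/n]*n m n ⟩
  m % n + m / n * n   <⟨ +-monoˡ-< (m / n * n) (m%n<n m n) ⟩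
  n + m / n * n       ≡⟨ *-comm (suc (m / n)) n ⟩
  n * suc (m / n)     ∎
  where open ≤-Reasoning

-- Holds since 4 is at most the `d`-th power of 4. This is how the constant 1/4 yields a factor 4 in
-- the exponent for all depths at once.
4*m^n≤[4*m]^n : ∀ τ d → 1 ≤ d → 4 * τ ^ d ≤ (4 * τ) ^ d
4*m^n≤[4*m]^n τ (suc d) _ = begin
  4 * (τ * τ ^ d)     ≡⟨ *-assoc 4 τ (τ ^ d) ⟨
  4 * τ * τ ^ d       ≤⟨ *-monoʳ-≤ (4 * τ) (^-monoˡ-≤ d (m≤n*m τ 4)) ⟩
  (4 * τ) ^ suc d     ∎
  where open ≤-Reasoning

-- The failing inequality is the wire bound with c = 1/4. For `τ = w / n`, having
-- `n < 2 ^ (4 * τ ^ d)` would restore it, because `4 * τ ^ d * n ^ d` is at most `(4 * w) ^ d`.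
wire-threshold : ∀ n w d → 16 ≤ n → 1 ≤ d → ¬ (n ^ ((1 * n) ^ d) ≤ 2 ^ ((4 * w) ^ d)) →
  ∃[ τ ] 1 ≤ τ × w < n * suc τ × 2 ^ (4 * τ ^ d) ≤ n
wire-threshold n@(suc _) w d 16≤n 1≤d few with w <? n
-- The quotient would be 0, so `τ` is raised to 1; the last condition then reads `2 ^ 4 ≤ n`.
... | yes w<n = 1 , ≤-refl , <-≤-trans w<n (m≤m*n n 2) ,
  subst (λ t → 2 ^ (4 * t) ≤ n) (sym (^-zeroˡ d)) 16≤n
... | no  w≮n = τ , m≥n⇒m/n>0 (≮⇒≥ w≮n) , m<n*[1+m/n] w n , ≮⇒≥ (few ∘ many)
  where
  τ = w / n
  many : n < 2 ^ (4 * τ ^ d) → n ^ ((1 * n) ^ d) ≤ 2 ^ ((4 * w) ^ d)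
  many n<2^ = begin
    n ^ ((1 * n) ^ d)                    ≡⟨ cong (λ k → n ^ (k ^ d)) (*-identityˡ n) ⟩
    n ^ (n ^ d)                          ≤⟨ ^-monoˡ-≤ (n ^ d) (<⇒≤ n<2^) ⟩
    (2 ^ (4 * τ ^ d)) ^ (n ^ d)          ≡⟨ ^-*-assoc 2 (4 * τ ^ d) (n ^ d) ⟩
    2 ^ (4 * τ ^ d * n ^ d)              ≤⟨ ^-monoʳ-≤ 2 (*-monoˡ-≤ (n ^ d) (4*m^n≤[4*m]^n τ d 1≤d)) ⟩
    2 ^ ((4 * τ) ^ d * n ^ d)            ≡⟨ cong (2 ^_) (^-distribʳ-* (4 * τ) n d) ⟨
    2 ^ ((4 * τ * n) ^ d)                ≡⟨ cong (λ k → 2 ^ (k ^ d)) (*-assoc 4 τ n) ⟩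
    2 ^ ((4 * (τ * n)) ^ d)              ≤⟨ ^-monoʳ-≤ 2 (^-monoˡ-≤ d (*-monoʳ-≤ 4 (m/n*n≤m w n))) ⟩
    2 ^ ((4 * w) ^ d)                    ∎
    where open ≤-Reasoning

2[2+ℓ]ℓ≤2^ℓ : ∀ {ℓ} → 8 ≤ ℓ → 2 * ((2 + ℓ) * ℓ) ≤ 2 ^ ℓ
2[2+ℓ]ℓ≤2^ℓ 8≤ℓ with m≤n⇒∃[o]m+o≡n 8≤ℓ
... | k , refl = from-8 k
  where
  -- Doubling the left side at `k` exceeds its value at `suc k` by a polynomial with natural
  -- coefficients, so the doubling of the power of two suffices.
  grow : ∀ k → 2 * ((10 + suc k) * (8 + suc k)) + 2 * (k * k + 16 * k + 61) ≡ 2 * (2 * ((10 + k) * (8 + k)))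
  grow = solve-∀

  from-8 : ∀ k → 2 * ((10 + k) * (8 + k)) ≤ 2 ^ (8 + k)
  from-8 zero    = ≤ᵇ⇒≤ 160 256 _
  from-8 (suc k) = begin
    2 * ((10 + suc k) * (8 + suc k))                                 ≤⟨ m≤m+n _ (2 * (k * k + 16 * k + 61)) ⟩
    2 * ((10 + suc k) * (8 + suc k)) + 2 * (k * k + 16 * k + 61)     ≡⟨ grow k ⟩
    2 * (2 * ((10 + k) * (8 + k)))                                   ≤⟨ *-monoʳ-≤ 2 (from-8 k) ⟩
    2 ^ (8 + suc k)                                                  ∎
    where open ≤-Reasoning

-- An address among `n + n` cells takes at most `2 + ℓ` bits, and a truth table `2 ^ T` bits. The
-- bound leaves at most n/4 bits per query, hence n² bits for all `4 * n` outputs.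
query-bits : ∀ ℓ T → 8 ≤ ℓ → T * 4 ≤ ℓ → 4 * ((2 + ℓ) * T + 2 ^ T) ≤ 2 ^ ℓ
query-bits ℓ T 8≤ℓ 4T≤ℓ = *-cancelˡ-≤ 2 (begin
  -- After doubling, the address part and the table part may each take up `2 ^ ℓ`.
  2 * (4 * ((2 + ℓ) * T + 2 ^ T))            ≡⟨ regroup (2 + ℓ) T (2 ^ T) ⟩
  2 * ((2 + ℓ) * (T * 4)) + 2 ^ (3 + T)      ≤⟨ +-mono-≤ (*-monoʳ-≤ 2 (*-monoʳ-≤ (2 + ℓ) 4T≤ℓ)) (^-monoʳ-≤ 2 3+T≤ℓ) ⟩
  2 * ((2 + ℓ) * ℓ) + 2 ^ ℓ                  ≤⟨ +-monoˡ-≤ (2 ^ ℓ) (2[2+ℓ]ℓ≤2^ℓ 8≤ℓ) ⟩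
  2 ^ ℓ + 2 ^ ℓ                              ≡⟨ cong (2 ^ ℓ +_) (+-identityʳ (2 ^ ℓ)) ⟨
  2 * 2 ^ ℓ                                  ∎)
  where
  open ≤-Reasoning
  regroup : ∀ a T x → 2 * (4 * (a * T + x)) ≡ 2 * (a * (T * 4)) + 2 * (2 * (2 * x))
  regroup = solve-∀
  3+T≤ℓ : 3 + T ≤ ℓ
  3+T≤ℓ = *-cancelʳ-≤ (3 + T) ℓ 4 (begin
    12 + T * 4           ≤⟨ +-mono-≤ (≤ᵇ⇒≤ 12 24 _) 4T≤ℓ ⟩
    8 * 3 + ℓ            ≤⟨ +-monoˡ-≤ ℓ (*-monoˡ-≤ 3 8≤ℓ) ⟩
    ℓ * 3 + ℓ            ≡⟨ eq ℓ ⟩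
    ℓ * 4                ∎)
    where
    eq : ∀ ℓ → ℓ * 3 + ℓ ≡ ℓ * 4
    eq = solve-∀

n<2^n : ∀ n → n < 2 ^ n
n<2^n zero    = s≤s z≤n
n<2^n (suc n) = begin-strict
  suc n           ≤⟨ n<2^n n ⟩
  2 ^ n           <⟨ ^-monoʳ-< 2 (s≤s (s≤s z≤n)) (n<1+n n) ⟩
  2 ^ suc n       ∎
  where open ≤-Reasoning

-- Of the 4n² bits of a matrix, the queries use at most n² and the memories 2n². The remaining n²
-- absorb the factor `q`, which is below `2 ^ n`; this margin makes the share of described matrices
-- at most 1/q.
few-schemes : ∀ {n ℓ T q} → 8 ≤ ℓ → 2 ^ ℓ ≤ n → n < 2 ^ suc ℓ → T * 4 ≤ ℓ → q ≤ n →
  #probe-schemes (4 * n) n (n + n) T * q ≤ 2 ^ (4 * n * n)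
few-schemes {n} {ℓ} {T} {q} 8≤ℓ 2^ℓ≤n n<2^[1+ℓ] 4T≤ℓ q≤n = begin
  #queries (n + n) T ^ (4 * n) * (2 ^ (n + n)) ^ n * q
    ≤⟨ *-mono-≤ (*-mono-≤ (^-monoˡ-≤ (4 * n) queries≤) (≤-reflexive (^-*-assoc 2 (n + n) n)))
                (≤-trans q≤n (<⇒≤ (n<2^n n))) ⟩
  (2 ^ β) ^ (4 * n) * 2 ^ ((n + n) * n) * 2 ^ n
    ≡⟨ cong (λ x → x * 2 ^ ((n + n) * n) * 2 ^ n) (^-*-assoc 2 β (4 * n)) ⟩
  2 ^ (β * (4 * n)) * 2 ^ ((n + n) * n) * 2 ^ n
    ≡⟨ cong (_* 2 ^ n) (^-distribˡ-+-* 2 (β * (4 * n)) ((n + n) * n)) ⟨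
  2 ^ (β * (4 * n) + (n + n) * n) * 2 ^ n
    ≡⟨ ^-distribˡ-+-* 2 (β * (4 * n) + (n + n) * n) n ⟨
  2 ^ (β * (4 * n) + (n + n) * n + n)
    ≤⟨ ^-monoʳ-≤ 2 exponent≤ ⟩
  2 ^ (4 * n * n) ∎
  where
  open ≤-Reasoning
  β = (2 + ℓ) * T + 2 ^ T

  n+n≤ : n + n ≤ 2 ^ (2 + ℓ)
  n+n≤ = begin
    n + n                        ≡⟨ cong (n +_) (+-identityʳ n) ⟨
    2 * n                        ≤⟨ *-monoʳ-≤ 2 (<⇒≤ n<2^[1+ℓ]) ⟩
    2 ^ (2 + ℓ)                 ∎

  queries≤ : #queries (n + n) T ≤ 2 ^ β
  queries≤ = begin
    (n + n) ^ T * 2 ^ (2 ^ T)           ≤⟨ *-monoˡ-≤ (2 ^ (2 ^ T)) (^-monoˡ-≤ T n+n≤) ⟩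
    (2 ^ (2 + ℓ)) ^ T * 2 ^ (2 ^ T)    ≡⟨ cong (_* 2 ^ (2 ^ T)) (^-*-assoc 2 (2 + ℓ) T) ⟩
    2 ^ ((2 + ℓ) * T) * 2 ^ (2 ^ T)    ≡⟨ ^-distribˡ-+-* 2 ((2 + ℓ) * T) (2 ^ T) ⟨
    2 ^ β                               ∎

  1≤n : 1 ≤ n
  1≤n = ≤-trans (m^n>0 2 (ℓ)) 2^ℓ≤n

  exponent≤ : β * (4 * n) + (n + n) * n + n ≤ 4 * n * n
  exponent≤ = begin
    β * (4 * n) + (n + n) * n + n       ≡⟨ left β n ⟩
    4 * β * n + 2 * (n * n) + 1 * n
      ≤⟨ +-mono-≤ (+-monoˡ-≤ (2 * (n * n)) (*-monoˡ-≤ n (≤-trans (query-bits ℓ T 8≤ℓ 4T≤ℓ) 2^ℓ≤n))) (*-monoˡ-≤ n 1≤n) ⟩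
    n * n + 2 * (n * n) + n * n         ≡⟨ right n ⟩
    4 * n * n                           ∎
    where
    left : ∀ b n → b * (4 * n) + (n + n) * n + n ≡ 4 * b * n + 2 * (n * n) + 1 * n
    left = solve-∀
    right : ∀ n → n * n + 2 * (n * n) + n * n ≡ 4 * n * n
    right = solve-∀

-- From counting to probability.

-- A positive fraction with denominator q is at least 1/q, and B/N is at most 1/q.
1-ε≤[N∸B]/N : ∀ {ε} N .{{_ : NonZero N}} B → 0ℚ ℚ.< ε → B * ↧ₙ ε ≤ N →
  1ℚ ℚ.- ε ℚ.≤ (ℤ.+ (N ∸ B)) ℚ./ N
1-ε≤[N∸B]/N {mkℚ ℤ.-[1+ _ ] _ _} _ _ (ℚ.*<* ()) _
1-ε≤[N∸B]/N {mkℚ (ℤ.+ 0) _ _} _ _ (ℚ.*<* (ℤ.+<+ ())) _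
1-ε≤[N∸B]/N {ε@(mkℚ (ℤ.+ suc p) q-1 _)} N@(suc N-1) B _ Bq≤N =
  subst (1ℚ ℚ.- ε ℚ.≤_) cancel (ℚ.+-monoˡ-≤ (ℚ.- ε) 1≤x+ε)
  where
  x = (ℤ.+ (N ∸ B)) ℚ./ N
  q = suc q-1

  cancel : x ℚ.+ ε ℚ.- ε ≡ x
  cancel = trans (ℚ.+-assoc x ε (ℚ.- ε)) (trans (cong (x ℚ.+_) (ℚ.+-inverseʳ ε)) (ℚ.+-identityʳ x))

  Nq≤ : 1 * (N * q) ≤ ((N ∸ B) * q + suc p * N) * 1
  Nq≤ = begin
    1 * (N * q)                          ≡⟨ *-identityˡ (N * q) ⟩
    N * q                                ≤⟨ m≤n+m∸n (N * q) (B * q) ⟩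
    B * q + (N * q ∸ B * q)              ≡⟨ cong (B * q +_) (*-distribʳ-∸ q N B) ⟨
    B * q + (N ∸ B) * q                  ≡⟨ +-comm (B * q) _ ⟩
    (N ∸ B) * q + B * q                  ≤⟨ +-monoʳ-≤ ((N ∸ B) * q) (≤-trans Bq≤N (m≤n*m N (suc p))) ⟩
    (N ∸ B) * q + suc p * N              ≡⟨ *-identityʳ _ ⟨
    ((N ∸ B) * q + suc p * N) * 1        ∎
    where open ≤-Reasoning

  1≤x+εᵘ : ℚ.toℚᵘ 1ℚ ℚᵘ.≤ mkℚᵘ (ℤ.+ (N ∸ B)) N-1 ℚᵘ.+ ℚ.toℚᵘ ε
  1≤x+εᵘ = ℚᵘ.*≤* (subst₂ ℤ._≤_ (ℤ.pos-* 1 (N * q))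
    (trans (ℤ.pos-* ((N ∸ B) * q + suc p * N) 1) (cong (ℤ._* ℤ.+ 1)
      (trans (ℤ.pos-+ ((N ∸ B) * q) (suc p * N)) (cong₂ ℤ._+_ (ℤ.pos-* (N ∸ B) q) (ℤ.pos-* (suc p) N)))))
    (ℤ.+≤+ Nq≤))

  1≤x+ε : 1ℚ ℚ.≤ x ℚ.+ ε
  1≤x+ε = ℚ.toℚᵘ-cancel-≤ (ℚᵘ.≤-respʳ-≃
    (ℚᵘ.≃-sym (ℚᵘ.≃-trans (ℚ.toℚᵘ-homo-+ x ε)
      (ℚᵘ.+-congˡ (ℚ.toℚᵘ ε) (ℚ.toℚᵘ-fromℚᵘ (mkℚᵘ (ℤ.+ (N ∸ B)) N-1)))))
    1≤x+εᵘ)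

probably-avoids : ∀ {ε B} {P : Matrix m n → Set} (bad : Fin B → Matrix m n) →
  0ℚ ℚ.< ε → B * ↧ₙ ε ≤ 2 ^ (m * n) → (∀ M → (∀ c → M ≢ bad c) → P M) → ProbAtLeast (1ℚ ℚ.- ε) P
probably-avoids {m} {n} {B = B} bad 0<ε few avoiding⇒P
  with remove-all (Vec.≡-dec (Vec.≡-dec Bool._≟_)) (matrices {m} {n}) bad
... | (f , f-injective) , f∌ =
  2 ^ (m * n) ∸ B ,
  1-ε≤[N∸B]/N (2 ^ (m * n)) {{m^n≢0 2 (m * n)}} B 0<ε few ,
  f , f-injective , λ i → avoiding⇒P (f i) (f∌ i)

-- The lower bound for most matrices.

avoiding⇒requires : ∀ {n d ℓ} (M : Matrix m n) → 1 ≤ d → 16 ≤ n → n < 2 ^ suc ℓ →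
  (∀ c → M ≢ scheme-matrix m n (n + n) (ℓ / 4) c) → RequiresWires (ℤ.+ 1 ℚ./ 4) d n M
avoiding⇒requires {n = n} {d} {ℓ} M 1≤d 16≤n n<2^[1+ℓ] M∌ K k (_ , shallow) k≤d computes =
  -- The wire bound is a decidable inequality of naturals, so refuting its negation is enough.
  decidable-stable (_ ≤? _) λ few →
    let τ , 1≤τ , w<n[1+τ] , 2^≤n = wire-threshold n (Circuit.wires K) d 16≤n 1≤d few
        -- Otherwise `2 ^ suc ℓ ≤ 2 ^ (4 * τ ^ d) ≤ n`, against the choice of `ℓ`.
        4τ^d≤ℓ = s≤s⁻¹ (≰⇒> λ ℓ<4τ^d → <⇒≱ n<2^[1+ℓ] (≤-trans (^-monoʳ-≤ 2 ℓ<4τ^d) 2^≤n))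
        τ^d≤ℓ/4 = subst (_≤ ℓ / 4) (m*n/n≡m (τ ^ d) 4)
                    (/-monoˡ-≤ 4 (subst (_≤ ℓ) (*-comm 4 (τ ^ d)) 4τ^d≤ℓ))
        c , scheme≡M = circuit⇒scheme K M (Fin.fromℕ< 0<n) 1≤τ w<n[1+τ]
                         (λ i j ℓ p → ≤-trans (shallow i j ℓ p) k≤d) τ^d≤ℓ/4 computes
    in M∌ c (sym scheme≡M)
  where
  0<n : 0 < n
  0<n = ≤-trans (s≤s z≤n) 16≤n

-- The matrices to avoid depend on `n` alone, through `ℓ / 4` probes. The thresholds on `n` are
-- therefore uniform in `d`, which lets the depth vary with `n`.
most-require : ∀ d → 1 ≤ d → ∀ ε → 0ℚ ℚ.< ε → ∀ n → 256 ≤ n → ↧ₙ ε ≤ n →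
  ProbAtLeast (1ℚ ℚ.- ε) (RequiresWires (ℤ.+ 1 ℚ./ 4) d {4 * n} n)
most-require d 1≤d ε 0<ε n 256≤n q≤n with log₂-bracket n (≤-trans (s≤s z≤n) 256≤n)
... | ℓ , 2^ℓ≤n , n<2^[1+ℓ] =
  probably-avoids (scheme-matrix (4 * n) n (n + n) (ℓ / 4)) 0<ε
    (few-schemes {n} {ℓ} {ℓ / 4} {↧ₙ ε} 8≤ℓ 2^ℓ≤n n<2^[1+ℓ] (m/n*n≤m ℓ 4) q≤n)
    (λ M → avoiding⇒requires {ℓ = ℓ} M 1≤d (≤-trans (≤ᵇ⇒≤ 16 256 _) 256≤n) n<2^[1+ℓ])
  where
  -- This is where 256, the eighth power of two, comes from.
  8≤ℓ : 8 ≤ ℓ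
  8≤ℓ = ≮⇒≥ λ ℓ<8 → <⇒≱ n<2^[1+ℓ] (≤-trans (^-monoʳ-≤ 2 ℓ<8) 256≤n)

theorem4p2 : ∃[ C ] ∃[ c ] 1 ≤ C × 0ℚ ℚ.< c ×
    ((d : ℕ → ℕ) → (∀ n → 1 ≤ d n) →
    WithHighProbability (λ n → C * n) (λ n M → RequiresWires c (d n) n M))
theorem4p2 = 4 , ℤ.+ 1 ℚ./ 4 , s≤s z≤n , ℚ.*<* (ℤ.+<+ (s≤s z≤n)) , λ d 1≤d ε 0<ε →
  256 + ↧ₙ ε , λ n N≤n →
    most-require (d n) (1≤d n) ε 0<ε n (≤-trans (m≤m+n 256 (↧ₙ ε)) N≤n) (≤-trans (m≤n+m (↧ₙ ε) 256) N≤n)
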